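{- For every $n\ge 1$, the optimal value $E(n)$ of the linear program $$\text{minimize } \sum_{u\in\mathbb{F}_2^n}x_u \quad\text{subject to}\quad 0\le x_u\le 1\ (u\in\mathbb{F}_2^n),\qquad x_v+\sum_{\substack{u\in\mathbb{F}_2^n,\ u\supset v\\ \mathrm{dist}(u,v)=1}}x_u\ \ge\ 1\ \ \text{for all } v\in\mathbb{F}_2^n,$$ is $$E(n)=(-1)^n\,n!\,\{R_n(2)-R_n(1)R_{n-1}(1)\},\qquad\text{where } R_n(x)=\sum_{k=0}^n\frac{(-x)^k}{k!}.$$
   Context: Subsets of an $n$-set are identified with their indicator vectors in $\mathbb{F}_2^n$; $u\supset v$ means the support of $u$ contains the support of $v$, and dist denotes Hamming distance. $R_n(x)$ is the degree-$n$ partial sum of the Taylor series of $e^{ -x}$. -}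

module Defs where

open import Algebra.Definitions.RawSemiring using (_^_)
open import Data.Bool.Base using (_xor_)
open import Data.Fin.Subset using (Subset; inside; outside; ∣_∣; _⊇_)
open import Data.Fin.Subset.Properties using (_⊆?_)
open import Data.Integer.Base using (+_)
open import Data.List.Base using (List; []; _∷_; _++_; map; filter; foldr)
open import Data.Nat.Base as ℕ using (ℕ; zero; suc; _!)
open import Data.Nat.Properties as ℕ using (_!≢0)
open import Data.Product.Base using (Σ-syntax; _×_; _,_)
open import Data.Rational.Base as ℚ using (ℚ; 0ℚ; 1ℚ; ½; _/_)
import Data.Rational.Properties as ℚ
open import Data.Rational.Solver using (module +-*-Solver)
open import Data.Vec.Base using ([]; _∷_; zipWith)
open import Relation.Binary.PropositionalEquality
  using (_≡_; refl; sym; trans; cong; subst)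
open import Relation.Nullary.Decidable using (Dec; _×-dec_)

-- Real numbers as Cauchy sequences of rationals.  They are compared with _≤_
-- and _≈_ below, never with _≡_.

IsCauchy : (ℕ → ℚ) → Set
IsCauchy s = ∀ ε → 0ℚ ℚ.< ε →
  Σ[ N ∈ ℕ ] (∀ j k → N ℕ.≤ j → N ℕ.≤ k → ℚ.∣ s j ℚ.- s k ∣ ℚ.≤ ε)

record ℝ : Set where
  constructor mkℝ
  field
    seq    : ℕ → ℚ
    cauchy : IsCauchy seq

open ℝ public

fromℚ : ℚ → ℝ
fromℚ q = mkℝ (λ _ → q) λ ε 0<ε → 0 , λ _ _ _ _ →
  subst (λ t → ℚ.∣ t ∣ ℚ.≤ ε) (sym (ℚ.+-inverseʳ q)) (ℚ.<⇒≤ 0<ε)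

0ℝ 1ℝ : ℝ
0ℝ = fromℚ 0ℚ
1ℝ = fromℚ 1ℚ

private
  half>0 : ∀ {ε} → 0ℚ ℚ.< ε → 0ℚ ℚ.< ½ ℚ.* ε
  half>0 {ε} 0<ε =
    subst (ℚ._< ½ ℚ.* ε) (ℚ.*-zeroʳ ½) (ℚ.*-monoʳ-<-pos ½ 0<ε)

  halves : ∀ ε → ½ ℚ.* ε ℚ.+ ½ ℚ.* ε ≡ ε
  halves ε = trans (sym (ℚ.*-distribʳ-+ ε ½ ½)) (ℚ.*-identityˡ ε)

  rearrange : ∀ a b c d →
    (a ℚ.+ b) ℚ.- (c ℚ.+ d) ≡ (a ℚ.- c) ℚ.+ (b ℚ.- d)
  rearrange = solve 4 (λ a b c d →
    (a :+ b) :- (c :+ d) := (a :- c) :+ (b :- d)) refl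
    where open +-*-Solver

  +-close : ∀ a b c d {ε} →
    ℚ.∣ a ℚ.- c ∣ ℚ.≤ ½ ℚ.* ε → ℚ.∣ b ℚ.- d ∣ ℚ.≤ ½ ℚ.* ε →
    ℚ.∣ (a ℚ.+ b) ℚ.- (c ℚ.+ d) ∣ ℚ.≤ ε
  +-close a b c d {ε} p q =
    subst (λ t → ℚ.∣ t ∣ ℚ.≤ ε) (sym (rearrange a b c d))
      (ℚ.≤-trans (ℚ.∣p+q∣≤∣p∣+∣q∣ (a ℚ.- c) (b ℚ.- d))
        (subst (_ ℚ.≤_) (halves ε) (ℚ.+-mono-≤ p q)))

  +-cauchy : ∀ s t → IsCauchy s → IsCauchy t → IsCauchy (λ k → s k ℚ.+ t k)
  +-cauchy s t s-cauchy t-cauchy ε 0<ε =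
    let (M , p) = s-cauchy (½ ℚ.* ε) (half>0 0<ε)
        (N , q) = t-cauchy (½ ℚ.* ε) (half>0 0<ε)
    in M ℕ.⊔ N , λ j k j≥ k≥ →
      +-close (s j) (t j) (s k) (t k)
        (p j k (ℕ.m⊔n≤o⇒m≤o M N j≥) (ℕ.m⊔n≤o⇒m≤o M N k≥))
        (q j k (ℕ.m⊔n≤o⇒n≤o M N j≥) (ℕ.m⊔n≤o⇒n≤o M N k≥))

infixl 6 _+_
_+_ : ℝ → ℝ → ℝ
x + y = mkℝ (λ k → seq x k ℚ.+ seq y k) (+-cauchy (seq x) (seq y) (cauchy x) (cauchy y))

infix 4 _≤_ _≥_ _≈_

-- A record, so that x and y can be inferred from the type x ≤ y.
record _≤_ (x y : ℝ) : Set where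
  constructor mk≤
  field
    eventually : ∀ ε → 0ℚ ℚ.< ε →
      Σ[ N ∈ ℕ ] (∀ k → N ℕ.≤ k → seq x k ℚ.≤ seq y k ℚ.+ ε)

open _≤_ public

_≥_ _≈_ : ℝ → ℝ → Set
x ≥ y = y ≤ x
x ≈ y = x ≤ y × y ≤ x

-- 𝔽₂ⁿ is represented by Subset n, i.e. by Boolean vectors of length n.

dist : ∀ {n} → Subset n → Subset n → ℕ
dist u v = ∣ zipWith _xor_ u v ∣

subsets : ∀ n → List (Subset n)
subsets zero    = [] ∷ []
subsets (suc n) = map (outside ∷_) (subsets n) ++ map (inside ∷_) (subsets n)

Covers : ∀ {n} → Subset n → Subset n → Set
Covers v u = u ⊇ v × dist u v ≡ 1

covers? : ∀ {n} (v u : Subset n) → Dec (Covers v u)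
covers? v u = (v ⊆? u) ×-dec (dist u v ℕ.≟ 1)

∑ : ∀ {A : Set} → List A → (A → ℝ) → ℝ
∑ us f = foldr (λ u s → f u + s) 0ℝ us

Feasible : ∀ n → (Subset n → ℝ) → Set
Feasible n x =
    (∀ u → 0ℝ ≤ x u × x u ≤ 1ℝ)
  × (∀ v → x v + ∑ (filter (covers? v) (subsets n)) x ≥ 1ℝ)

objective : ∀ n → (Subset n → ℝ) → ℝ
objective n x = ∑ (subsets n) x

IsOptimalValue : ℕ → ℝ → Set
IsOptimalValue n e =
    (Σ[ x ∈ (Subset n → ℝ) ] Feasible n x × objective n x ≈ e)
  × (∀ x → Feasible n x → e ≤ objective n x)

infixr 8 _^ℚ_
_^ℚ_ : ℚ → ℕ → ℚ
_^ℚ_ = _^_ ℚ.+-*-rawSemiring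

fromℕ : ℕ → ℚ
fromℕ m = + m / 1

expTerm : ℕ → ℚ → ℚ
expTerm k x = ((ℚ.- x) ^ℚ k) ℚ.* ((+ 1 / (k !)) {{k !≢0}})

R : ℕ → ℚ → ℚ
R zero    x = expTerm zero x
R (suc n) x = R n x ℚ.+ expTerm (suc n) x

{-# OPTIONS --safe #-}
module Submission where

-- Write D k = (-1)ᵏ k! (Rₖ(1) − Rₘ(1)).  Then D (k+1) + (k+1) D k = 1, D m = 0 and
-- D (m+1) = 1, and running the recurrence downwards keeps D in [0,1] for k ≤ m+1.
-- With m = n−1, the point |u| ↦ D |u| is dual feasible; with m = n, the point
-- |u| ↦ D (n−|u|), raised to 1 at the full set, is primal feasible.
-- Their values are binomial transforms of D.  Because (-1)ᵏ k! Rₖ(x) satisfies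
-- a (k+1) = xᵏ⁺¹ − (k+1) a k, its binomial transform is (-1)ⁿ n! Rₙ(1+x), which
-- at x = 0 and x = 1 evaluates both values to the stated formula.
-- Weak duality is applied to the rational approximations of a real feasible point.

open import Defs
open import Data.Nat.Base using (ℕ; _∸_; _!) renaming (_≤_ to _≤ℕ_)
open import Data.Rational.Base using (1ℚ; -_; _*_; _-_)

open import Data.Nat.Base as ℕ using (zero; suc; pred; z≤n; s≤s)
import Data.Nat.Properties as ℕ
open import Data.Integer.Base as ℤ using (+_)
import Data.Integer.Properties as ℤ
open import Data.Rational.Base as ℚ using (ℚ; 0ℚ; ½; _/_)
import Data.Rational.Properties as ℚ
import Data.Rational.Unnormalised.Base as ℚᵘ
import Data.Rational.Unnormalised.Properties as ℚᵘ
open import Data.Rational.Solver using (module +-*-Solver)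
open import Algebra.Bundles using (CommutativeRing)
import Algebra.Properties.CommutativeSemiring.Exp as Exp
open import Data.Bool.Base using (true; false; if_then_else_)
open import Data.Fin.Subset using (Subset; inside; outside; ∣_∣; ∁)
open import Data.Fin.Subset.Properties using (drop-∷-⊆; out⊆; s⊆s; ⊆-refl; ∣p∣≤n)
open import Data.List.Base using (List; []; _∷_; _++_; map; filter; foldr)
open import Data.Product.Base using (Σ-syntax; _×_; _,_; proj₁; proj₂)
open import Data.Sum.Base using (inj₁; inj₂)
open import Data.Vec.Base using ([]; _∷_; here)
open import Function.Base using (_∘_)
open import Relation.Binary.PropositionalEquality
open import Relation.Nullary using (Dec; yes; no; does; contradiction)
open import Relation.Nullary.Decidable using (dec-true; dec-false)

open +-*-Solver using (solve; _:+_; _:*_; _:-_; :-_; _:=_; con)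

private
  variable
    n : ℕ

-- Sums over subsets

-- Splitting on the first coordinate follows the recursion of `subsets`, so sums can be handled by
-- induction on the dimension without lists; `∑ℚ-subsets` makes the link.
total : (Subset n → ℚ) → ℚ
total {zero}  f = f []
total {suc n} f = total (f ∘ (outside ∷_)) ℚ.+ total (f ∘ (inside ∷_))

interchange : ∀ a b c d → (a ℚ.+ b) ℚ.+ (c ℚ.+ d) ≡ (a ℚ.+ c) ℚ.+ (b ℚ.+ d)
interchange = solve 4 (λ a b c d → (a :+ b) :+ (c :+ d) := (a :+ c) :+ (b :+ d)) refl

total-cong : {f g : Subset n → ℚ} → (∀ u → f u ≡ g u) → total f ≡ total g
total-cong {zero}  f≗g = f≗g []
total-cong {suc n} f≗g = cong₂ ℚ._+_ (total-cong (f≗g ∘ (outside ∷_))) (total-cong (f≗g ∘ (inside ∷_)))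

total-mono : {f g : Subset n → ℚ} → (∀ u → f u ℚ.≤ g u) → total f ℚ.≤ total g
total-mono {zero}  f≤g = f≤g []
total-mono {suc n} f≤g = ℚ.+-mono-≤ (total-mono (f≤g ∘ (outside ∷_))) (total-mono (f≤g ∘ (inside ∷_)))

total-+ : (f g : Subset n → ℚ) → total (λ u → f u ℚ.+ g u) ≡ total f ℚ.+ total g
total-+ {zero}  f g = refl
total-+ {suc n} f g = trans
  (cong₂ ℚ._+_ (total-+ (f ∘ (outside ∷_)) (g ∘ (outside ∷_))) (total-+ (f ∘ (inside ∷_)) (g ∘ (inside ∷_))))
  (interchange (total (f ∘ (outside ∷_))) (total (g ∘ (outside ∷_)))
               (total (f ∘ (inside ∷_))) (total (g ∘ (inside ∷_))))

total-zero : {f : Subset n → ℚ} → (∀ u → f u ≡ 0ℚ) → total f ≡ 0ℚ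
total-zero {zero}  f≗0 = f≗0 []
total-zero {suc n} f≗0 = cong₂ ℚ._+_ (total-zero (f≗0 ∘ (outside ∷_))) (total-zero (f≗0 ∘ (inside ∷_)))

total-single : (f : Subset n → ℚ) (v : Subset n) → (∀ u → u ≢ v → f u ≡ 0ℚ) → total f ≡ f v
total-single f []            off = refl
total-single f (outside ∷ v) off = trans
  (cong₂ ℚ._+_
    (total-single (f ∘ (outside ∷_)) v λ u u≢v → off (outside ∷ u) λ { refl → u≢v refl })
    (total-zero λ u → off (inside ∷ u) λ ()))
  (ℚ.+-identityʳ _)
total-single f (inside ∷ v)  off = trans
  (cong₂ ℚ._+_
    (total-zero λ u → off (outside ∷ u) λ ())
    (total-single (f ∘ (inside ∷_)) v λ u u≢v → off (inside ∷ u) λ { refl → u≢v refl }))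
  (ℚ.+-identityˡ _)

-- Each dimension doubles the number of sets and halves the budget, so `δ` is ε / 2ⁿ. It pays for
-- the uniform repair of a nearly feasible point.
spread : ∀ n ε → 0ℚ ℚ.< ε → Σ[ δ ∈ ℚ ] 0ℚ ℚ.< δ × total {n} (λ _ → δ) ≡ ε
spread zero    ε 0<ε = ε , 0<ε , refl
spread (suc n) ε 0<ε =
  let δ , 0<δ , eq = spread n (½ * ε) (subst (ℚ._< ½ * ε) (ℚ.*-zeroʳ ½) (ℚ.*-monoʳ-<-pos ½ 0<ε))
  in δ , 0<δ , trans (cong₂ ℚ._+_ eq eq) (trans (sym (ℚ.*-distribʳ-+ ε ½ ½)) (ℚ.*-identityˡ ε))

-- Neighbour sums and weak duality

upperSum : Subset n → (Subset n → ℚ) → ℚ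
upperSum []            f = 0ℚ
upperSum (outside ∷ v) f = f (inside ∷ v) ℚ.+ upperSum v (f ∘ (outside ∷_))
upperSum (inside ∷ v)  f = upperSum v (f ∘ (inside ∷_))

-- The transpose of `upperSum`: neighbours are reached by removing one element, where `upperSum`
-- adds one.
lowerSum : Subset n → (Subset n → ℚ) → ℚ
lowerSum []            f = 0ℚ
lowerSum (outside ∷ u) f = lowerSum u (f ∘ (outside ∷_))
lowerSum (inside ∷ u)  f = f (outside ∷ u) ℚ.+ lowerSum u (f ∘ (inside ∷_))

upperSum-mono : (v : Subset n) {f g : Subset n → ℚ} → (∀ u → f u ℚ.≤ g u) → upperSum v f ℚ.≤ upperSum v g
upperSum-mono []            f≤g = ℚ.≤-refl
upperSum-mono (outside ∷ v) f≤g = ℚ.+-mono-≤ (f≤g _) (upperSum-mono v (f≤g ∘ (outside ∷_)))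
upperSum-mono (inside ∷ v)  f≤g = upperSum-mono v (f≤g ∘ (inside ∷_))

total-*-distribˡ-+ : (f g h : Subset n → ℚ) →
  total (λ u → f u * (g u ℚ.+ h u)) ≡ total (λ u → f u * g u) ℚ.+ total (λ u → f u * h u)
total-*-distribˡ-+ f g h = trans (total-cong λ u → ℚ.*-distribˡ-+ (f u) (g u) (h u)) (total-+ (λ u → f u * g u) (λ u → f u * h u))

-- Both sides add up `s v * x u` over all pairs in which `u` covers `v`. In the inductive step the
-- pairs differing in the first coordinate contribute the sum of `sₒ * xᵢ`, which sits with the
-- `outside` half on the left and with the `inside` half on the right.
upperSum-lowerSum-adjoint : (s x : Subset n → ℚ) →
  total (λ v → s v * upperSum v x) ≡ total (λ u → x u * lowerSum u s)
upperSum-lowerSum-adjoint {zero}  s x = trans (ℚ.*-zeroʳ (s [])) (sym (ℚ.*-zeroʳ (x [])))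
upperSum-lowerSum-adjoint {suc n} s x = begin
  total (λ v → sₒ v * (xᵢ v ℚ.+ upperSum v xₒ)) ℚ.+ total (λ v → sᵢ v * upperSum v xᵢ)
    ≡⟨ cong₂ ℚ._+_ (total-*-distribˡ-+ sₒ xᵢ (λ v → upperSum v xₒ)) (upperSum-lowerSum-adjoint sᵢ xᵢ) ⟩
  (total (λ v → sₒ v * xᵢ v) ℚ.+ total (λ v → sₒ v * upperSum v xₒ)) ℚ.+ total (λ u → xᵢ u * lowerSum u sᵢ)
    ≡⟨ cong (ℚ._+ total (λ u → xᵢ u * lowerSum u sᵢ)) (cong₂ ℚ._+_ (total-cong λ u → ℚ.*-comm (sₒ u) (xᵢ u)) (upperSum-lowerSum-adjoint sₒ xₒ)) ⟩
  (total (λ u → xᵢ u * sₒ u) ℚ.+ total (λ u → xₒ u * lowerSum u sₒ)) ℚ.+ total (λ u → xᵢ u * lowerSum u sᵢ)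
    ≡⟨ cong (ℚ._+ total (λ u → xᵢ u * lowerSum u sᵢ)) (ℚ.+-comm (total (λ u → xᵢ u * sₒ u)) (total (λ u → xₒ u * lowerSum u sₒ))) ⟩
  (total (λ u → xₒ u * lowerSum u sₒ) ℚ.+ total (λ u → xᵢ u * sₒ u)) ℚ.+ total (λ u → xᵢ u * lowerSum u sᵢ)
    ≡⟨ ℚ.+-assoc (total (λ u → xₒ u * lowerSum u sₒ)) (total (λ u → xᵢ u * sₒ u)) (total (λ u → xᵢ u * lowerSum u sᵢ)) ⟩
  total (λ u → xₒ u * lowerSum u sₒ) ℚ.+ (total (λ u → xᵢ u * sₒ u) ℚ.+ total (λ u → xᵢ u * lowerSum u sᵢ))
    ≡⟨ cong (total (λ u → xₒ u * lowerSum u sₒ) ℚ.+_) (sym (total-*-distribˡ-+ xᵢ sₒ (λ u → lowerSum u sᵢ))) ⟩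
  total (λ u → xₒ u * lowerSum u sₒ) ℚ.+ total (λ u → xᵢ u * (sₒ u ℚ.+ lowerSum u sᵢ)) ∎
  where
  open ≡-Reasoning
  sₒ = s ∘ (outside ∷_)
  sᵢ = s ∘ (inside ∷_)
  xₒ = x ∘ (outside ∷_)
  xᵢ = x ∘ (inside ∷_)

p≤p+q : ∀ p {q} → 0ℚ ℚ.≤ q → p ℚ.≤ p ℚ.+ q
p≤p+q p {q} 0≤q = subst (ℚ._≤ p ℚ.+ q) (ℚ.+-identityʳ p) (ℚ.+-monoʳ-≤ p 0≤q)

*-monoˡ-≤ : ∀ {p q} r → 0ℚ ℚ.≤ r → p ℚ.≤ q → r * p ℚ.≤ r * q
*-monoˡ-≤ r 0≤r = ℚ.*-monoˡ-≤-nonNeg r {{ℚ.nonNegative 0≤r}}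

-- Weight the covering constraint at `v` by `s v`, sum over `v`, exchange the summations by
-- adjointness, and apply the packing constraint at each `u`.
weak-duality : (s x : Subset n → ℚ) →
  (∀ v → 0ℚ ℚ.≤ s v) → (∀ u → s u ℚ.+ lowerSum u s ℚ.≤ 1ℚ) →
  (∀ u → 0ℚ ℚ.≤ x u) → (∀ v → 1ℚ ℚ.≤ x v ℚ.+ upperSum v x) →
  total s ℚ.≤ total x
weak-duality s x 0≤s s≤1 0≤x 1≤x = begin
  total s
    ≤⟨ total-mono (λ v → subst (ℚ._≤ s v * (x v ℚ.+ upperSum v x)) (ℚ.*-identityʳ (s v)) (*-monoˡ-≤ (s v) (0≤s v) (1≤x v))) ⟩
  total (λ v → s v * (x v ℚ.+ upperSum v x))
    ≡⟨ total-*-distribˡ-+ s x (λ v → upperSum v x) ⟩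
  total (λ v → s v * x v) ℚ.+ total (λ v → s v * upperSum v x)
    ≡⟨ cong₂ ℚ._+_ (total-cong λ v → ℚ.*-comm (s v) (x v)) (upperSum-lowerSum-adjoint s x) ⟩
  total (λ u → x u * s u) ℚ.+ total (λ u → x u * lowerSum u s)
    ≡⟨ sym (total-*-distribˡ-+ x s (λ u → lowerSum u s)) ⟩
  total (λ u → x u * (s u ℚ.+ lowerSum u s))
    ≤⟨ total-mono (λ u → subst (x u * (s u ℚ.+ lowerSum u s) ℚ.≤_) (ℚ.*-identityʳ (x u)) (*-monoˡ-≤ (x u) (0≤x u) (s≤1 u))) ⟩
  total x ∎
  where open ℚ.≤-Reasoning

-- Functions of the cardinality

-- `+ m / 1` is normalised by a gcd and does not reduce for a variable `m`; on unnormalised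
-- rationals the claim becomes an identity of integers.
fromℕ-suc : ∀ m → fromℕ (suc m) ≡ 1ℚ ℚ.+ fromℕ m
fromℕ-suc m = ℚ.toℚᵘ-injective (begin
  ℚ.toℚᵘ (fromℕ (suc m))              ≈⟨ ℚ.toℚᵘ-fromℚᵘ (ℚᵘ.mkℚᵘ (+ suc m) 0) ⟩
  ℚᵘ.mkℚᵘ (+ suc m) 0                 ≈⟨ ℚᵘ.*≡* (cong (λ k → (+ 1 ℤ.+ k) ℤ.* + 1) (sym (ℤ.*-identityʳ (+ m)))) ⟩
  ℚᵘ.1ℚᵘ ℚᵘ.+ ℚᵘ.mkℚᵘ (+ m) 0         ≈⟨ ℚᵘ.+-congʳ ℚᵘ.1ℚᵘ (ℚ.toℚᵘ-fromℚᵘ (ℚᵘ.mkℚᵘ (+ m) 0)) ⟨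
  ℚᵘ.1ℚᵘ ℚᵘ.+ ℚ.toℚᵘ (fromℕ m)        ≈⟨ ℚ.toℚᵘ-homo-+ 1ℚ (fromℕ m) ⟨
  ℚ.toℚᵘ (1ℚ ℚ.+ fromℕ m)             ∎)
  where open ℚᵘ.≃-Reasoning

fromℕ-* : ∀ m k → fromℕ (m ℕ.* k) ≡ fromℕ m * fromℕ k
fromℕ-* zero    k = sym (ℚ.*-zeroˡ (fromℕ k))
fromℕ-* (suc m) k = trans (fromℕ-+ k (m ℕ.* k)) (trans (cong (fromℕ k ℚ.+_) (fromℕ-* m k))
  (trans (solve 2 (λ a b → b :+ a :* b := (con 1ℚ :+ a) :* b) refl (fromℕ m) (fromℕ k))
         (cong (_* fromℕ k) (sym (fromℕ-suc m)))))
  where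
  fromℕ-+ : ∀ m k → fromℕ (m ℕ.+ k) ≡ fromℕ m ℚ.+ fromℕ k
  fromℕ-+ zero    k = sym (ℚ.+-identityˡ (fromℕ k))
  fromℕ-+ (suc m) k = trans (fromℕ-suc (m ℕ.+ k)) (trans (cong (1ℚ ℚ.+_) (fromℕ-+ m k))
    (trans (sym (ℚ.+-assoc 1ℚ (fromℕ m) (fromℕ k))) (cong (ℚ._+ fromℕ k) (sym (fromℕ-suc m)))))

0≤fromℕ : ∀ m → 0ℚ ℚ.≤ fromℕ m
0≤fromℕ m = ℚ.nonNegative⁻¹ (fromℕ m) {{ℚ.normalize-nonNeg m 1}}

fromℕ-inverseʳ : ∀ d .{{_ : ℕ.NonZero d}} → fromℕ d * (+ 1 / d) ≡ 1ℚ
fromℕ-inverseʳ (suc d) = ℚ.toℚᵘ-injective (begin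
  ℚ.toℚᵘ (fromℕ (suc d) * (+ 1 / suc d))              ≈⟨ ℚ.toℚᵘ-homo-* (fromℕ (suc d)) (+ 1 / suc d) ⟩
  ℚ.toℚᵘ (fromℕ (suc d)) ℚᵘ.* ℚ.toℚᵘ (+ 1 / suc d)    ≈⟨ ℚᵘ.*-cong (ℚ.toℚᵘ-fromℚᵘ (ℚᵘ.mkℚᵘ (+ suc d) 0)) (ℚ.toℚᵘ-fromℚᵘ (ℚᵘ.mkℚᵘ (+ 1) d)) ⟩
  ℚᵘ.mkℚᵘ (+ suc d) 0 ℚᵘ.* ℚᵘ.mkℚᵘ (+ 1) d            ≈⟨ ℚᵘ.*≡* (trans (ℤ.*-identityʳ (+ suc d ℤ.* + 1))
                                                           (trans (ℤ.*-comm (+ suc d) (+ 1)) (sym (ℤ.*-identityˡ (+ 1 ℤ.* + suc d))))) ⟩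
  ℚᵘ.1ℚᵘ                                              ∎)
  where open ℚᵘ.≃-Reasoning

fromℕ-suc-* : ∀ k q → fromℕ (suc k) * q ≡ q ℚ.+ fromℕ k * q
fromℕ-suc-* k q = trans (cong (_* q) (fromℕ-suc k))
  (solve 2 (λ a b → (con 1ℚ :+ a) :* b := b :+ a :* b) refl (fromℕ k) q)

-- At k = 0 the truncated predecessor is harmless, its coefficient being 0.
fromℕ-*-suc-pred : ∀ k (g : ℕ → ℚ) → fromℕ k * g (suc (pred k)) ≡ fromℕ k * g k
fromℕ-*-suc-pred zero    g = trans (ℚ.*-zeroˡ (g 1)) (sym (ℚ.*-zeroˡ (g 0)))
fromℕ-*-suc-pred (suc k) g = refl

-- Every missing element gives one upper neighbour, whose complement is smaller by one. The size of
-- the complement is used in place of n - |v| because it computes along the vector.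
upperSum-∣∁∣ : (v : Subset n) (g : ℕ → ℚ) →
  upperSum v (λ u → g ∣ ∁ u ∣) ≡ fromℕ ∣ ∁ v ∣ * g (pred ∣ ∁ v ∣)
upperSum-∣∁∣ []            g = sym (ℚ.*-zeroˡ (g 0))
upperSum-∣∁∣ (outside ∷ v) g = trans
  (cong (g ∣ ∁ v ∣ ℚ.+_) (trans (upperSum-∣∁∣ v (g ∘ suc)) (fromℕ-*-suc-pred ∣ ∁ v ∣ g)))
  (sym (fromℕ-suc-* ∣ ∁ v ∣ (g ∣ ∁ v ∣)))
upperSum-∣∁∣ (inside ∷ v)  g = upperSum-∣∁∣ v g

lowerSum-∣∣ : (u : Subset n) (g : ℕ → ℚ) →
  lowerSum u (λ v → g ∣ v ∣) ≡ fromℕ ∣ u ∣ * g (pred ∣ u ∣)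
lowerSum-∣∣ []            g = sym (ℚ.*-zeroˡ (g 0))
lowerSum-∣∣ (outside ∷ u) g = lowerSum-∣∣ u g
lowerSum-∣∣ (inside ∷ u)  g = trans
  (cong (g ∣ u ∣ ℚ.+_) (trans (lowerSum-∣∣ u (g ∘ suc)) (fromℕ-*-suc-pred ∣ u ∣ g)))
  (sym (fromℕ-suc-* ∣ u ∣ (g ∣ u ∣)))

-- ∑ₖ C(n,k) g(k), by Pascal's rule.
binomialSum : ℕ → (ℕ → ℚ) → ℚ
binomialSum zero    g = g 0
binomialSum (suc n) g = binomialSum n g ℚ.+ binomialSum n (g ∘ suc)

total-∣∣ : ∀ n (g : ℕ → ℚ) → total {n} (λ u → g ∣ u ∣) ≡ binomialSum n g
total-∣∣ zero    g = refl
total-∣∣ (suc n) g = cong₂ ℚ._+_ (total-∣∣ n g) (total-∣∣ n (g ∘ suc))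

total-∣∁∣ : ∀ n (g : ℕ → ℚ) → total {n} (λ u → g ∣ ∁ u ∣) ≡ binomialSum n g
total-∣∁∣ zero    g = refl
total-∣∁∣ (suc n) g = trans (cong₂ ℚ._+_ (total-∣∁∣ n (g ∘ suc)) (total-∣∁∣ n g))
  (ℚ.+-comm (binomialSum n (g ∘ suc)) (binomialSum n g))

binomialSum-cong : ∀ n {f g : ℕ → ℚ} → (∀ k → f k ≡ g k) → binomialSum n f ≡ binomialSum n g
binomialSum-cong zero    f≗g = f≗g 0
binomialSum-cong (suc n) f≗g = cong₂ ℚ._+_ (binomialSum-cong n f≗g) (binomialSum-cong n (f≗g ∘ suc))

binomialSum-linear : ∀ n c (f g : ℕ → ℚ) →
  binomialSum n (λ k → f k ℚ.+ c * g k) ≡ binomialSum n f ℚ.+ c * binomialSum n g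
binomialSum-linear zero    c f g = refl
binomialSum-linear (suc n) c f g = trans
  (cong₂ ℚ._+_ (binomialSum-linear n c f g) (binomialSum-linear n c (f ∘ suc) (g ∘ suc)))
  (solve 5 (λ c a b d e → (a :+ c :* b) :+ (d :+ c :* e) := (a :+ d) :+ c :* (b :+ e)) refl c
    (binomialSum n f) (binomialSum n g) (binomialSum n (f ∘ suc)) (binomialSum n (g ∘ suc)))

-- The absorption identity k C(n+1,k) = (n+1) C(n,k-1), obtained from Pascal's rule by induction.
binomialSum-absorb : ∀ n (g : ℕ → ℚ) →
  binomialSum (suc n) (λ k → fromℕ k * g (pred k)) ≡ fromℕ (suc n) * binomialSum n g
binomialSum-absorb zero    g = solve 1 (λ a → con 0ℚ :* a :+ con 1ℚ :* a := con 1ℚ :* a) refl (g 0)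
binomialSum-absorb (suc n) g = begin
  binomialSum (suc n) (λ k → fromℕ k * g (pred k)) ℚ.+ binomialSum (suc n) (λ k → fromℕ (suc k) * g k)
    ≡⟨ cong₂ ℚ._+_ (binomialSum-absorb n g) (binomialSum-cong (suc n) split) ⟩
  N * binomialSum n g ℚ.+ binomialSum (suc n) (λ k → g k ℚ.+ 1ℚ * (fromℕ k * g (suc (pred k))))
    ≡⟨ cong (N * binomialSum n g ℚ.+_) (binomialSum-linear (suc n) 1ℚ g (λ k → fromℕ k * g (suc (pred k)))) ⟩
  N * binomialSum n g ℚ.+ (binomialSum (suc n) g ℚ.+ 1ℚ * binomialSum (suc n) (λ k → fromℕ k * g (suc (pred k))))
    ≡⟨ cong (λ t → N * binomialSum n g ℚ.+ (binomialSum (suc n) g ℚ.+ 1ℚ * t)) (binomialSum-absorb n (g ∘ suc)) ⟩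
  N * binomialSum n g ℚ.+ (binomialSum (suc n) g ℚ.+ 1ℚ * (N * binomialSum n (g ∘ suc)))
    ≡⟨ solve 3 (λ N a b → N :* a :+ ((a :+ b) :+ con 1ℚ :* (N :* b)) := (a :+ b) :+ N :* (a :+ b)) refl
         N (binomialSum n g) (binomialSum n (g ∘ suc)) ⟩
  binomialSum (suc n) g ℚ.+ N * binomialSum (suc n) g
    ≡⟨ sym (fromℕ-suc-* (suc n) (binomialSum (suc n) g)) ⟩
  fromℕ (suc (suc n)) * binomialSum (suc n) g ∎
  where
  open ≡-Reasoning
  N = fromℕ (suc n)
  split : ∀ k → fromℕ (suc k) * g k ≡ g k ℚ.+ 1ℚ * (fromℕ k * g (suc (pred k)))
  split k = trans (fromℕ-suc-* k (g k)) (cong (g k ℚ.+_)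
    (trans (sym (fromℕ-*-suc-pred k g)) (sym (ℚ.*-identityˡ _))))

binomialSum-^ : ∀ n x → binomialSum n (x ^ℚ_) ≡ (1ℚ ℚ.+ x) ^ℚ n
binomialSum-^ zero    x = refl
binomialSum-^ (suc n) x = begin
  binomialSum n (x ^ℚ_) ℚ.+ binomialSum n (λ k → x * x ^ℚ k)
    ≡⟨ cong (binomialSum n (x ^ℚ_) ℚ.+_) (trans (binomialSum-cong n λ k → sym (ℚ.+-identityˡ _))
         (binomialSum-linear n x (λ _ → 0ℚ) (x ^ℚ_))) ⟩
  binomialSum n (x ^ℚ_) ℚ.+ (binomialSum n (λ _ → 0ℚ) ℚ.+ x * binomialSum n (x ^ℚ_))
    ≡⟨ cong (λ t → binomialSum n (x ^ℚ_) ℚ.+ (t ℚ.+ x * binomialSum n (x ^ℚ_))) (zeros n) ⟩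
  binomialSum n (x ^ℚ_) ℚ.+ (0ℚ ℚ.+ x * binomialSum n (x ^ℚ_))
    ≡⟨ solve 2 (λ x a → a :+ (con 0ℚ :+ x :* a) := (con 1ℚ :+ x) :* a) refl x (binomialSum n (x ^ℚ_)) ⟩
  (1ℚ ℚ.+ x) * binomialSum n (x ^ℚ_)
    ≡⟨ cong ((1ℚ ℚ.+ x) *_) (binomialSum-^ n x) ⟩
  (1ℚ ℚ.+ x) * (1ℚ ℚ.+ x) ^ℚ n ∎
  where
  open ≡-Reasoning
  zeros : ∀ n → binomialSum n (λ _ → 0ℚ) ≡ 0ℚ
  zeros zero    = refl
  zeros (suc n) = cong₂ ℚ._+_ (zeros n) (zeros n)

-- Signed factorials times the partial sums

signedFactorial : ℕ → ℚ
signedFactorial n = (- 1ℚ) ^ℚ n * fromℕ (n !)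

signedFactorial-suc : ∀ n → signedFactorial (suc n) ≡ - (fromℕ (suc n) * signedFactorial n)
signedFactorial-suc n = trans
  (cong ((- 1ℚ) * (- 1ℚ) ^ℚ n *_) (fromℕ-* (suc n) (n !)))
  (solve 3 (λ e N f → :- con 1ℚ :* e :* (N :* f) := :- (N :* (e :* f))) refl
    ((- 1ℚ) ^ℚ n) (fromℕ (suc n)) (fromℕ (n !)))

-- The sign cancels that of (-x)ⁿ and the factorial cancels the denominator.
signedFactorial-expTerm : ∀ n x → signedFactorial n * expTerm n x ≡ x ^ℚ n
signedFactorial-expTerm n x = begin
  (- 1ℚ) ^ℚ n * fromℕ (n !) * ((- x) ^ℚ n * n!⁻¹)
    ≡⟨ solve 4 (λ a b c d → a :* b :* (c :* d) := (a :* c) :* (b :* d)) refl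
         ((- 1ℚ) ^ℚ n) (fromℕ (n !)) ((- x) ^ℚ n) n!⁻¹ ⟩
  ((- 1ℚ) ^ℚ n * (- x) ^ℚ n) * (fromℕ (n !) * n!⁻¹)
    ≡⟨ cong₂ _*_ (sym (^-distrib-* (- 1ℚ) (- x) n)) (fromℕ-inverseʳ (n !) {{n ℕ.!≢0}}) ⟩
  ((- 1ℚ) * (- x)) ^ℚ n * 1ℚ
    ≡⟨ ℚ.*-identityʳ _ ⟩
  ((- 1ℚ) * (- x)) ^ℚ n
    ≡⟨ cong (_^ℚ n) (solve 1 (λ x → :- con 1ℚ :* :- x := x) refl x) ⟩
  x ^ℚ n ∎
  where
  open ≡-Reasoning
  open Exp (CommutativeRing.commutativeSemiring ℚ.+-*-commutativeRing) using (^-distrib-*)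
  n!⁻¹ = (+ 1 / (n !)) {{n ℕ.!≢0}}

signedR : ℚ → ℕ → ℚ
signedR x n = signedFactorial n * R n x

-- The new Taylor term is cleared to a pure power, while the older terms pick up the factor -(n+1)
-- by which the signed factorial grows.
signedR-suc : ∀ x n → signedR x (suc n) ≡ x ^ℚ suc n ℚ.+ (- 1ℚ) * (fromℕ (suc n) * signedR x n)
signedR-suc x n = begin
  signedFactorial (suc n) * (R n x ℚ.+ expTerm (suc n) x)
    ≡⟨ ℚ.*-distribˡ-+ (signedFactorial (suc n)) (R n x) (expTerm (suc n) x) ⟩
  signedFactorial (suc n) * R n x ℚ.+ signedFactorial (suc n) * expTerm (suc n) x
    ≡⟨ cong₂ ℚ._+_ (cong (_* R n x) (signedFactorial-suc n)) (signedFactorial-expTerm (suc n) x) ⟩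
  - (fromℕ (suc n) * signedFactorial n) * R n x ℚ.+ x ^ℚ suc n
    ≡⟨ solve 4 (λ N f r p → :- (N :* f) :* r :+ p := p :+ :- con 1ℚ :* (N :* (f :* r))) refl
         (fromℕ (suc n)) (signedFactorial n) (R n x) (x ^ℚ suc n) ⟩
  x ^ℚ suc n ℚ.+ (- 1ℚ) * (fromℕ (suc n) * signedR x n) ∎
  where open ≡-Reasoning

-- The binomial transform respects the recurrence signedR-suc and turns x ^ n into (1 + x) ^ n.
binomialSum-signedR : ∀ n x → binomialSum n (signedR x) ≡ signedR (1ℚ ℚ.+ x) n
binomialSum-signedR zero    x = refl
binomialSum-signedR (suc n) x = begin
  binomialSum (suc n) (signedR x)
    ≡⟨ binomialSum-cong (suc n) unfold ⟩
  binomialSum (suc n) (λ k → x ^ℚ k ℚ.+ (- 1ℚ) * (fromℕ k * signedR x (pred k)))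
    ≡⟨ binomialSum-linear (suc n) (- 1ℚ) (x ^ℚ_) (λ k → fromℕ k * signedR x (pred k)) ⟩
  binomialSum (suc n) (x ^ℚ_) ℚ.+ (- 1ℚ) * binomialSum (suc n) (λ k → fromℕ k * signedR x (pred k))
    ≡⟨ cong₂ (λ a b → a ℚ.+ (- 1ℚ) * b) (binomialSum-^ (suc n) x) (trans (binomialSum-absorb n (signedR x))
         (cong (fromℕ (suc n) *_) (binomialSum-signedR n x))) ⟩
  (1ℚ ℚ.+ x) ^ℚ suc n ℚ.+ (- 1ℚ) * (fromℕ (suc n) * signedR (1ℚ ℚ.+ x) n)
    ≡⟨ sym (signedR-suc (1ℚ ℚ.+ x) n) ⟩
  signedR (1ℚ ℚ.+ x) (suc n) ∎
  where
  open ≡-Reasoning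
  -- The recurrence in a form valid at every index, as `binomialSum-cong` requires: at 0 the
  -- coefficient `fromℕ 0` removes the spurious predecessor.
  unfold : ∀ k → signedR x k ≡ x ^ℚ k ℚ.+ (- 1ℚ) * (fromℕ k * signedR x (pred k))
  unfold zero    = solve 1 (λ a → con 1ℚ := con 1ℚ :+ :- con 1ℚ :* (con 0ℚ :* a)) refl (signedR x 0)
  unfold (suc k) = signedR-suc x k

1^n≡1 : ∀ n → 1ℚ ^ℚ n ≡ 1ℚ
1^n≡1 zero    = refl
1^n≡1 (suc n) = trans (ℚ.*-identityˡ _) (1^n≡1 n)

R-0 : ∀ n → R n 0ℚ ≡ 1ℚ
R-0 zero    = refl
R-0 (suc n) = trans (cong₂ ℚ._+_ (R-0 n) (trans (cong (_* inv) (ℚ.*-zeroˡ ((- 0ℚ) ^ℚ n))) (ℚ.*-zeroˡ inv))) (ℚ.+-identityʳ 1ℚ)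
  where inv = (+ 1 / (suc n !)) {{suc n ℕ.!≢0}}

-- The weights: recurrence, bounds and binomial transform

R₁ : ℕ → ℚ
R₁ n = R n (fromℕ 1)

-- For k ≤ m this is the finite alternating sum 1/(k+1) - 1/((k+1)(k+2)) + ⋯, whose last denominator
-- is m!/k!.
weight : ℕ → ℕ → ℚ
weight m k = signedFactorial k * (R₁ k - R₁ m)

-- The Taylor term added at k+1 contributes exactly 1, and the rest cancels since the signed
-- factorial is multiplied by -(k+1). Read on sets, this makes a constraint with k+1 neighbours
-- tight.
weight-suc : ∀ m k → weight m (suc k) ℚ.+ fromℕ (suc k) * weight m k ≡ 1ℚ
weight-suc m k = begin
  signedFactorial (suc k) * ((R₁ k ℚ.+ t) - R₁ m) ℚ.+ N * weight m k
    ≡⟨ solve 5 (λ f a t b c → f :* ((a :+ t) :- b) :+ c := (f :* t :+ f :* (a :- b)) :+ c) refl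
         (signedFactorial (suc k)) (R₁ k) t (R₁ m) (N * weight m k) ⟩
  (signedFactorial (suc k) * t ℚ.+ signedFactorial (suc k) * (R₁ k - R₁ m)) ℚ.+ N * weight m k
    ≡⟨ cong (ℚ._+ N * weight m k) (cong₂ ℚ._+_
         (trans (signedFactorial-expTerm (suc k) 1ℚ) (1^n≡1 (suc k)))
         (cong (_* (R₁ k - R₁ m)) (signedFactorial-suc k))) ⟩
  (1ℚ ℚ.+ - (N * signedFactorial k) * (R₁ k - R₁ m)) ℚ.+ N * weight m k
    ≡⟨ solve 3 (λ N f d → (con 1ℚ :+ :- (N :* f) :* d) :+ N :* (f :* d) := con 1ℚ) refl
         N (signedFactorial k) (R₁ k - R₁ m) ⟩
  1ℚ ∎
  where
  open ≡-Reasoning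
  N = fromℕ (suc k)
  t = expTerm (suc k) (fromℕ 1)

weight-self : ∀ m → weight m m ≡ 0ℚ
weight-self m = trans (cong (signedFactorial m *_) (ℚ.+-inverseʳ (R₁ m))) (ℚ.*-zeroʳ (signedFactorial m))

weight-self-suc : ∀ m → weight m (suc m) ≡ 1ℚ
weight-self-suc m = begin
  weight m (suc m)                                   ≡⟨ sym (ℚ.+-identityʳ _) ⟩
  weight m (suc m) ℚ.+ 0ℚ                            ≡⟨ cong (weight m (suc m) ℚ.+_) (sym (ℚ.*-zeroʳ (fromℕ (suc m)))) ⟩
  weight m (suc m) ℚ.+ fromℕ (suc m) * 0ℚ            ≡⟨ cong (λ t → weight m (suc m) ℚ.+ fromℕ (suc m) * t) (sym (weight-self m)) ⟩
  weight m (suc m) ℚ.+ fromℕ (suc m) * weight m m    ≡⟨ weight-suc m m ⟩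
  1ℚ                                                 ∎
  where open ≡-Reasoning

0≤1 : 0ℚ ℚ.≤ 1ℚ
0≤1 = 0≤fromℕ 1

InUnitInterval : ℚ → Set
InUnitInterval q = 0ℚ ℚ.≤ q × q ℚ.≤ 1ℚ

-- The relation gives p = (1 - q)/(k+1), and 1 - q lies in [0,1] with q.
unitInterval-descend : ∀ k p q → q ℚ.+ fromℕ (suc k) * p ≡ 1ℚ → InUnitInterval q → InUnitInterval p
unitInterval-descend k p q eq (0≤q , q≤1) = 0≤p , (begin
  p                   ≤⟨ p≤p+q p 0≤kp ⟩
  p ℚ.+ fromℕ k * p   ≡⟨ sym (fromℕ-suc-* k p) ⟩
  Np                  ≤⟨ subst (ℚ._≤ q ℚ.+ Np) (ℚ.+-identityˡ Np) (ℚ.+-monoˡ-≤ Np 0≤q) ⟩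
  q ℚ.+ Np            ≡⟨ eq ⟩
  1ℚ                  ∎)
  where
  open ℚ.≤-Reasoning
  Np = fromℕ (suc k) * p
  0≤Np : 0ℚ ℚ.≤ Np
  0≤Np = begin
    0ℚ               ≡⟨ sym (ℚ.+-inverseʳ q) ⟩
    q - q            ≤⟨ ℚ.+-monoˡ-≤ (- q) q≤1 ⟩
    1ℚ - q           ≡⟨ cong (_- q) (sym eq) ⟩
    (q ℚ.+ Np) - q   ≡⟨ solve 2 (λ a b → (a :+ b) :- a := b) refl q Np ⟩
    Np               ∎
  0≤p : 0ℚ ℚ.≤ p
  0≤p = ℚ.*-cancelˡ-≤-pos (fromℕ (suc k)) {{ℚ.normalize-pos (suc k) 1}}
    (subst (ℚ._≤ Np) (sym (ℚ.*-zeroʳ (fromℕ (suc k)))) 0≤Np)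
  0≤kp : 0ℚ ℚ.≤ fromℕ k * p
  0≤kp = subst (ℚ._≤ fromℕ k * p) (ℚ.*-zeroʳ (fromℕ k)) (*-monoˡ-≤ (fromℕ k) (0≤fromℕ k) 0≤p)

unitInterval-below : (w : ℕ → ℚ) → (∀ k → w (suc k) ℚ.+ fromℕ (suc k) * w k ≡ 1ℚ) →
  ∀ N → InUnitInterval (w N) → ∀ {k} → k ℕ.≤ N → InUnitInterval (w k)
unitInterval-below w rec zero    w∈ z≤n = w∈
unitInterval-below w rec (suc N) w∈ k≤N with ℕ.m≤n⇒m<n∨m≡n k≤N
... | inj₁ (s≤s k≤N′) = unitInterval-below w rec N (unitInterval-descend N (w N) (w (suc N)) (rec N) w∈) k≤N′
... | inj₂ refl       = w∈

-- The descent starts from the value 1 at m+1, so the range includes the full set in dimension m+1,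
-- where the dual point lives.
weight∈[0,1] : ∀ m {k} → k ℕ.≤ suc m → InUnitInterval (weight m k)
weight∈[0,1] m = unitInterval-below (weight m) (weight-suc m) (suc m)
  (subst InUnitInterval (sym (weight-self-suc m)) (0≤1 , ℚ.≤-refl))

-- Since `R k 0ℚ` is 1, the signed factorial alone is `signedR 0ℚ`, so the weight is a combination
-- of `signedR` at 1 and at 0. The transform shifts these arguments to 2 and 1.
binomialSum-weight : ∀ n m → binomialSum n (weight m) ≡ signedFactorial n * (R n (fromℕ 2) - R₁ n * R₁ m)
binomialSum-weight n m = begin
  binomialSum n (weight m)
    ≡⟨ binomialSum-cong n expand ⟩
  binomialSum n (λ k → signedR 1ℚ k ℚ.+ (- R₁ m) * signedR 0ℚ k)
    ≡⟨ binomialSum-linear n (- R₁ m) (signedR 1ℚ) (signedR 0ℚ) ⟩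
  binomialSum n (signedR 1ℚ) ℚ.+ (- R₁ m) * binomialSum n (signedR 0ℚ)
    ≡⟨ cong₂ (λ a b → a ℚ.+ (- R₁ m) * b) (binomialSum-signedR n 1ℚ) (binomialSum-signedR n 0ℚ) ⟩
  signedFactorial n * R n (fromℕ 2) ℚ.+ (- R₁ m) * (signedFactorial n * R₁ n)
    ≡⟨ solve 4 (λ f a b c → f :* a :+ :- c :* (f :* b) := f :* (a :- b :* c)) refl
         (signedFactorial n) (R n (fromℕ 2)) (R₁ n) (R₁ m) ⟩
  signedFactorial n * (R n (fromℕ 2) - R₁ n * R₁ m) ∎
  where
  open ≡-Reasoning
  expand : ∀ k → weight m k ≡ signedR 1ℚ k ℚ.+ (- R₁ m) * signedR 0ℚ k
  expand k = trans
    (solve 3 (λ f a b → f :* (a :- b) := f :* a :+ :- b :* (f :* con 1ℚ)) refl (signedFactorial k) (R₁ k) (R₁ m))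
    (cong (λ t → signedR 1ℚ k ℚ.+ (- R₁ m) * (signedFactorial k * t)) (sym (R-0 k)))

-- Rational primal and dual solutions

optimum : ℕ → ℚ
optimum n = signedFactorial n * (R n (fromℕ 2) - R₁ n * R₁ (n ∸ 1))

-- The value at a set u of the primal optimum, as a function of n - |u|.
primal : ℕ → ℕ → ℚ
primal n zero    = 1ℚ
primal n (suc k) = weight n (suc k)

primal∈[0,1] : ∀ n {k} → k ℕ.≤ n → InUnitInterval (primal n k)
primal∈[0,1] n {zero}  k≤n = 0≤1 , ℚ.≤-refl
primal∈[0,1] n {suc k} k≤n = weight∈[0,1] n (ℕ.m≤n⇒m≤1+n k≤n)

-- The full set has no upper neighbour and needs the value 1. A set missing one element is then
-- covered by the full set, so nonnegativity suffices; with two or more missing elements the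
-- recurrence gives equality.
primal-covers : ∀ n {k} → k ℕ.≤ n → 1ℚ ℚ.≤ primal n k ℚ.+ fromℕ k * primal n (pred k)
primal-covers n {zero}        k≤n = ℚ.≤-refl
primal-covers n {suc zero}    k≤n = ℚ.+-monoˡ-≤ 1ℚ (proj₁ (primal∈[0,1] n k≤n))
primal-covers n {suc (suc k)} k≤n = ℚ.≤-reflexive (sym (weight-suc n (suc k)))

-- Raising the value at 0 from 1 - `R₁ 1+m` to 1 adds `R₁ 1+m` times the sequence 0ᵏ, whose
-- transform is 1. This correction turns one factor `R₁ 1+m` of the transformed weight into `R₁ m`.
binomialSum-primal : ∀ m → binomialSum (suc m) (primal (suc m)) ≡ optimum (suc m)
binomialSum-primal m = begin
  binomialSum 1+m (primal 1+m)
    ≡⟨ binomialSum-cong 1+m correct ⟩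
  binomialSum 1+m (λ k → weight 1+m k ℚ.+ R₁ 1+m * 0ℚ ^ℚ k)
    ≡⟨ binomialSum-linear 1+m (R₁ 1+m) (weight 1+m) (0ℚ ^ℚ_) ⟩
  binomialSum 1+m (weight 1+m) ℚ.+ R₁ 1+m * binomialSum 1+m (0ℚ ^ℚ_)
    ≡⟨ cong₂ (λ a b → a ℚ.+ R₁ 1+m * b) (binomialSum-weight 1+m 1+m)
         -- The transform 1 is rewritten as `signedFactorial 1+m * t`, with `t` the last term of
         -- `R₁ 1+m`, so that the ring solver can cancel it.
         (trans (binomialSum-^ 1+m 0ℚ) (trans (1^n≡1 1+m) (sym (trans (signedFactorial-expTerm 1+m 1ℚ) (1^n≡1 1+m))))) ⟩
  signedFactorial 1+m * (R 1+m (fromℕ 2) - R₁ 1+m * (R₁ m ℚ.+ t)) ℚ.+ R₁ 1+m * (signedFactorial 1+m * t)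
    ≡⟨ solve 5 (λ f a r s t → f :* (a :- r :* (s :+ t)) :+ r :* (f :* t) := f :* (a :- r :* s)) refl
         (signedFactorial 1+m) (R 1+m (fromℕ 2)) (R₁ 1+m) (R₁ m) t ⟩
  optimum 1+m ∎
  where
  open ≡-Reasoning
  1+m = suc m
  t = expTerm 1+m (fromℕ 1)
  correct : ∀ k → primal 1+m k ≡ weight 1+m k ℚ.+ R₁ 1+m * 0ℚ ^ℚ k
  correct zero    = solve 1 (λ r → con 1ℚ := con 1ℚ :* (con 1ℚ :- r) :+ r :* con 1ℚ) refl (R₁ 1+m)
  correct (suc k) = sym (trans (cong (λ z → weight 1+m (suc k) ℚ.+ R₁ 1+m * z) (ℚ.*-zeroˡ (0ℚ ^ℚ k)))
    (trans (cong (weight 1+m (suc k) ℚ.+_) (ℚ.*-zeroʳ (R₁ 1+m))) (ℚ.+-identityʳ _)))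

-- The empty set has no lower neighbour, which leaves the bound by 1; every other constraint is
-- tight by the recurrence.
dual-packs : ∀ m {k} → k ℕ.≤ suc m → weight m k ℚ.+ fromℕ k * weight m (pred k) ℚ.≤ 1ℚ
dual-packs m {zero}  k≤ = subst (ℚ._≤ 1ℚ)
  (sym (trans (cong (weight m 0 ℚ.+_) (ℚ.*-zeroˡ (weight m 0))) (ℚ.+-identityʳ _)))
  (proj₂ (weight∈[0,1] m k≤))
dual-packs m {suc k} k≤ = ℚ.≤-reflexive (weight-suc m k)

optimum-≤ : ∀ m (x : Subset (suc m) → ℚ) → (∀ u → 0ℚ ℚ.≤ x u) → (∀ v → 1ℚ ℚ.≤ x v ℚ.+ upperSum v x) →
  optimum (suc m) ℚ.≤ total x
optimum-≤ m x 0≤x 1≤x = subst (ℚ._≤ total x)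
  (trans (total-∣∣ (suc m) (weight m)) (binomialSum-weight (suc m) m))
  (weak-duality (λ u → weight m ∣ u ∣) x
    (λ v → proj₁ (weight∈[0,1] m (∣p∣≤n v)))
    (λ u → subst (ℚ._≤ 1ℚ) (cong (weight m ∣ u ∣ ℚ.+_) (sym (lowerSum-∣∣ u (weight m)))) (dual-packs m (∣p∣≤n u)))
    0≤x 1≤x)

-- List sums and the covering relation

∑ℚ : ∀ {A : Set} → List A → (A → ℚ) → ℚ
∑ℚ us f = foldr (λ u s → f u ℚ.+ s) 0ℚ us

seq-∑ : ∀ {A : Set} (us : List A) (x : A → ℝ) k → seq (∑ us x) k ≡ ∑ℚ us (λ u → seq (x u) k)
seq-∑ []       x k = refl
seq-∑ (u ∷ us) x k = cong (seq (x u) k ℚ.+_) (seq-∑ us x k)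

∑ℚ-++ : ∀ {A : Set} (us vs : List A) (f : A → ℚ) → ∑ℚ (us ++ vs) f ≡ ∑ℚ us f ℚ.+ ∑ℚ vs f
∑ℚ-++ []       vs f = sym (ℚ.+-identityˡ _)
∑ℚ-++ (u ∷ us) vs f = trans (cong (f u ℚ.+_) (∑ℚ-++ us vs f)) (sym (ℚ.+-assoc (f u) _ _))

∑ℚ-map : ∀ {A B : Set} (h : A → B) (us : List A) (f : B → ℚ) → ∑ℚ (map h us) f ≡ ∑ℚ us (f ∘ h)
∑ℚ-map h []       f = refl
∑ℚ-map h (u ∷ us) f = cong (f (h u) ℚ.+_) (∑ℚ-map h us f)

∑ℚ-filter : ∀ {A : Set} {P : A → Set} (P? : ∀ u → Dec (P u)) (us : List A) (f : A → ℚ) →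
  ∑ℚ (filter P? us) f ≡ ∑ℚ us (λ u → if does (P? u) then f u else 0ℚ)
∑ℚ-filter P? []       f = refl
∑ℚ-filter P? (u ∷ us) f with does (P? u)
... | true  = cong (f u ℚ.+_) (∑ℚ-filter P? us f)
... | false = trans (∑ℚ-filter P? us f) (sym (ℚ.+-identityˡ _))

∑ℚ-subsets : ∀ n (f : Subset n → ℚ) → ∑ℚ (subsets n) f ≡ total f
∑ℚ-subsets zero    f = ℚ.+-identityʳ (f [])
∑ℚ-subsets (suc n) f = trans (∑ℚ-++ (map (outside ∷_) (subsets n)) (map (inside ∷_) (subsets n)) f)
  (cong₂ ℚ._+_ (trans (∑ℚ-map (outside ∷_) (subsets n) f) (∑ℚ-subsets n (f ∘ (outside ∷_))))
               (trans (∑ℚ-map (inside ∷_) (subsets n) f) (∑ℚ-subsets n (f ∘ (inside ∷_)))))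

dist-refl : (u : Subset n) → dist u u ≡ 0
dist-refl []            = refl
dist-refl (outside ∷ u) = dist-refl u
dist-refl (inside ∷ u)  = dist-refl u

dist≡0⇒≡ : (u v : Subset n) → dist u v ≡ 0 → u ≡ v
dist≡0⇒≡ []            []            eq = refl
dist≡0⇒≡ (outside ∷ u) (outside ∷ v) eq = cong (outside ∷_) (dist≡0⇒≡ u v eq)
dist≡0⇒≡ (inside ∷ u)  (inside ∷ v)  eq = cong (inside ∷_) (dist≡0⇒≡ u v eq)

if-dec : ∀ {A B : Set} (a? : Dec A) (b? : Dec B) → (A → B) → (B → A) → (q : ℚ) →
  (if does a? then q else 0ℚ) ≡ (if does b? then q else 0ℚ)
if-dec a? (yes b) to from q = cong (if_then q else 0ℚ) (dec-true a? (from b))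
if-dec a? (no ¬b) to from q = cong (if_then q else 0ℚ) (dec-false a? (¬b ∘ to))

-- Split on the first coordinate. When `u` and `v` agree there, covering is decided by the tails;
-- when only `v` has the element, `u` cannot contain `v`.
total-covers : (v : Subset n) (f : Subset n → ℚ) →
  total (λ u → if does (covers? v u) then f u else 0ℚ) ≡ upperSum v f
total-covers []            f = refl
total-covers (outside ∷ v) f = trans
  (cong₂ ℚ._+_
    (trans (total-cong λ u → if-dec (covers? (outside ∷ v) (outside ∷ u)) (covers? v u)
                               (λ (⊇ , eq) → drop-∷-⊆ ⊇ , eq) (λ (⊇ , eq) → out⊆ ⊇ , eq) _)
           (total-covers v (f ∘ (outside ∷_))))
    (trans (total-single _ v λ u u≢v → cong (if_then f (inside ∷ u) else 0ℚ)
              (dec-false (covers? (outside ∷ v) (inside ∷ u))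
                λ (_ , eq) → u≢v (dist≡0⇒≡ u v (ℕ.suc-injective eq))))
           (cong (if_then f (inside ∷ v) else 0ℚ)
              (dec-true (covers? (outside ∷ v) (inside ∷ v)) (out⊆ ⊆-refl , cong suc (dist-refl v))))))
  (ℚ.+-comm (upperSum v (f ∘ (outside ∷_))) (f (inside ∷ v)))
total-covers (inside ∷ v)  f = trans
  (cong₂ ℚ._+_
    (total-zero λ u → cong (if_then f (outside ∷ u) else 0ℚ)
       (dec-false (covers? (inside ∷ v) (outside ∷ u)) λ (⊇ , _) → contradiction (⊇ here) λ ()))
    (trans (total-cong λ u → if-dec (covers? (inside ∷ v) (inside ∷ u)) (covers? v u)
                               (λ (⊇ , eq) → drop-∷-⊆ ⊇ , eq) (λ (⊇ , eq) → s⊆s ⊇ , eq) _)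
           (total-covers v (f ∘ (inside ∷_)))))
  (ℚ.+-identityˡ _)

seq-objective : ∀ n (x : Subset n → ℝ) k → seq (objective n x) k ≡ total (λ u → seq (x u) k)
seq-objective n x k = trans (seq-∑ (subsets n) x k) (∑ℚ-subsets n _)

seq-∑-covers : (v : Subset n) (x : Subset n → ℝ) → ∀ k →
  seq (∑ (filter (covers? v) (subsets n)) x) k ≡ upperSum v (λ u → seq (x u) k)
seq-∑-covers {n} v x k = begin
  seq (∑ (filter (covers? v) (subsets n)) x) k                          ≡⟨ seq-∑ (filter (covers? v) (subsets n)) x k ⟩
  ∑ℚ (filter (covers? v) (subsets n)) xₖ                                ≡⟨ ∑ℚ-filter (covers? v) (subsets n) xₖ ⟩
  ∑ℚ (subsets n) (λ u → if does (covers? v u) then xₖ u else 0ℚ)        ≡⟨ ∑ℚ-subsets n _ ⟩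
  total (λ u → if does (covers? v u) then xₖ u else 0ℚ)                 ≡⟨ total-covers v xₖ ⟩
  upperSum v xₖ                                                         ∎
  where
  open ≡-Reasoning
  xₖ : Subset n → ℚ
  xₖ u = seq (x u) k

-- Passage to the reals

pointwise-≤ : ∀ {x y} → (∀ k → seq x k ℚ.≤ seq y k) → x ≤ y
pointwise-≤ x≤y = mk≤ λ ε 0<ε → 0 , λ k _ → ℚ.≤-trans (x≤y k) (p≤p+q _ (ℚ.<⇒≤ 0<ε))

Eventually : (ℕ → Set) → Set
Eventually P = Σ[ N ∈ ℕ ] (∀ k → N ℕ.≤ k → P k)

eventually-× : ∀ {P Q : ℕ → Set} → Eventually P → Eventually Q → Eventually (λ k → P k × Q k)
eventually-× (M , p) (N , q) = M ℕ.⊔ N , λ k k≥ →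
  p k (ℕ.m⊔n≤o⇒m≤o M N k≥) , q k (ℕ.m⊔n≤o⇒n≤o M N k≥)

eventually-map : ∀ {P Q : ℕ → Set} → (∀ k → P k → Q k) → Eventually P → Eventually Q
eventually-map f (N , p) = N , λ k k≥ → f k (p k k≥)

-- There are finitely many sets, so the maximum of their thresholds serves all of them.
eventually-∀ : (P : Subset n → ℕ → Set) → (∀ u → Eventually (P u)) → Eventually (λ k → ∀ u → P u k)
eventually-∀ {zero}  P ev = eventually-map (λ { k p [] → p }) (ev [])
eventually-∀ {suc n} P ev = eventually-map (λ { k (p , q) (outside ∷ u) → p u ; k (p , q) (inside ∷ u) → q u })
  (eventually-× (eventually-∀ (P ∘ (outside ∷_)) (ev ∘ (outside ∷_))) (eventually-∀ (P ∘ (inside ∷_)) (ev ∘ (inside ∷_))))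

-- A rational approximation violates the constraints by at most δ; adding δ to every coordinate repairs it.
optimum-≤-relaxed : ∀ m δ (x : Subset (suc m) → ℚ) → 0ℚ ℚ.≤ δ →
  (∀ u → 0ℚ ℚ.≤ x u ℚ.+ δ) → (∀ v → 1ℚ ℚ.≤ (x v ℚ.+ upperSum v x) ℚ.+ δ) →
  optimum (suc m) ℚ.≤ total x ℚ.+ total {suc m} (λ _ → δ)
optimum-≤-relaxed m δ x 0≤δ nonneg covering = begin
  optimum (suc m)                          ≤⟨ optimum-≤ m (λ u → x u ℚ.+ δ) nonneg covering′ ⟩
  total (λ u → x u ℚ.+ δ)                  ≡⟨ total-+ x (λ _ → δ) ⟩
  total x ℚ.+ total {suc m} (λ _ → δ)      ∎
  where
  open ℚ.≤-Reasoning
  covering′ : ∀ v → 1ℚ ℚ.≤ (x v ℚ.+ δ) ℚ.+ upperSum v (λ u → x u ℚ.+ δ)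
  covering′ v = begin
    1ℚ                                           ≤⟨ covering v ⟩
    (x v ℚ.+ upperSum v x) ℚ.+ δ                 ≡⟨ solve 3 (λ a b c → (a :+ b) :+ c := (a :+ c) :+ b) refl (x v) (upperSum v x) δ ⟩
    (x v ℚ.+ δ) ℚ.+ upperSum v x                 ≤⟨ ℚ.+-monoʳ-≤ (x v ℚ.+ δ) (upperSum-mono v λ u → p≤p+q (x u) 0≤δ) ⟩
    (x v ℚ.+ δ) ℚ.+ upperSum v (λ u → x u ℚ.+ δ) ∎

module _ (m : ℕ) (x : Subset (suc m) → ℝ) (feasible : Feasible (suc m) x) where

  private
    xₖ : ℕ → Subset (suc m) → ℚ
    xₖ k u = seq (x u) k

    Nonneg Covering : ℚ → Subset (suc m) → ℕ → Set
    Nonneg   δ u k = 0ℚ ℚ.≤ xₖ k u ℚ.+ δ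
    Covering δ v k = 1ℚ ℚ.≤ (xₖ k v ℚ.+ upperSum v (xₖ k)) ℚ.+ δ

    nonneg : ∀ {δ} → 0ℚ ℚ.< δ → ∀ u → Eventually (Nonneg δ u)
    nonneg {δ} 0<δ u = eventually (proj₁ (proj₁ feasible u)) δ 0<δ

    covering : ∀ {δ} → 0ℚ ℚ.< δ → ∀ v → Eventually (Covering δ v)
    covering {δ} 0<δ v = eventually-map
      (λ k → subst (λ t → 1ℚ ℚ.≤ (xₖ k v ℚ.+ t) ℚ.+ δ) (seq-∑-covers v x k))
      (eventually (proj₂ feasible v) δ 0<δ)

    combine : ∀ {δ ε} → 0ℚ ℚ.< δ → total {suc m} (λ _ → δ) ≡ ε →
      ∀ k → (∀ u → Nonneg δ u k) × (∀ v → Covering δ v k) →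
      optimum (suc m) ℚ.≤ seq (objective (suc m) x) k ℚ.+ ε
    combine {δ} {ε} 0<δ spreads k (nonnegₖ , coveringₖ) = begin
      optimum (suc m)                            ≤⟨ optimum-≤-relaxed m δ (xₖ k) (ℚ.<⇒≤ 0<δ) nonnegₖ coveringₖ ⟩
      total (xₖ k) ℚ.+ total {suc m} (λ _ → δ)   ≡⟨ cong (total (xₖ k) ℚ.+_) spreads ⟩
      total (xₖ k) ℚ.+ ε                         ≡⟨ cong (ℚ._+ ε) (seq-objective (suc m) x k) ⟨
      seq (objective (suc m) x) k ℚ.+ ε          ∎
      where open ℚ.≤-Reasoning

    bound : ∀ {δ ε} → 0ℚ ℚ.< δ → total {suc m} (λ _ → δ) ≡ ε →
      Eventually (λ k → optimum (suc m) ℚ.≤ seq (objective (suc m) x) k ℚ.+ ε)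
    bound {δ} 0<δ spreads =
      let N , both = eventually-× {λ k → ∀ u → Nonneg δ u k} {λ k → ∀ v → Covering δ v k}
                       (eventually-∀ (Nonneg δ) (nonneg 0<δ)) (eventually-∀ (Covering δ) (covering 0<δ))
      in N , λ k N≤k → combine 0<δ spreads k (both k N≤k)

  optimum-≤-objective : fromℚ (optimum (suc m)) ≤ objective (suc m) x
  optimum-≤-objective = mk≤ λ ε 0<ε →
    -- The tolerance `δ` is fixed before the threshold index: adding it to every coordinate raises
    -- the objective by exactly `ε`.
    let δ , 0<δ , spreads = spread (suc m) ε 0<ε in bound 0<δ spreads

-- The real primal optimum and the theorem

primalPoint : ∀ n → Subset n → ℝ
primalPoint n u = fromℚ (primal n ∣ ∁ u ∣)

-- The coordinates are constant sequences, so each real inequality follows from the rational one at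
-- every index.
primalPoint-feasible : ∀ n → Feasible n (primalPoint n)
primalPoint-feasible n =
  (λ u → let 0≤p , p≤1 = primal∈[0,1] n (∣p∣≤n (∁ u)) in
         pointwise-≤ (λ _ → 0≤p) , pointwise-≤ (λ _ → p≤1)) ,
  (λ v → pointwise-≤ λ k → subst (1ℚ ℚ.≤_)
    (cong (primal n ∣ ∁ v ∣ ℚ.+_) (sym (trans (seq-∑-covers v (primalPoint n) k) (upperSum-∣∁∣ v (primal n)))))
    (primal-covers n (∣p∣≤n (∁ v))))

primalPoint-objective : ∀ m k → seq (objective (suc m) (primalPoint (suc m))) k ≡ optimum (suc m)
primalPoint-objective m k = trans (seq-objective (suc m) (primalPoint (suc m)) k)
  (trans (total-∣∁∣ (suc m) (primal (suc m))) (binomialSum-primal m))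

theorem2 : ∀ (n : ℕ) → 1 ≤ℕ n →
    IsOptimalValue n
    (fromℚ ((- 1ℚ) ^ℚ n * fromℕ (n !) * (R n (fromℕ 2) - R n (fromℕ 1) * R (n ∸ 1) (fromℕ 1))))
theorem2 (suc m) _ =
  -- Here `suc m ∸ 1` computes to `m`, so the stated formula is `optimum (suc m)` by definition.
  (primalPoint (suc m) , primalPoint-feasible (suc m) ,
    pointwise-≤ (λ k → ℚ.≤-reflexive (primalPoint-objective m k)) ,
    pointwise-≤ (λ k → ℚ.≤-reflexive (sym (primalPoint-objective m k)))) ,
  optimum-≤-objective m
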